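{- For every integer $n \geq 3$, the collapsibility number of the Vietoris–Rips complex $\mathcal{VR}(\mathbb{I}_n;2)$ of the $n$-dimensional hypercube graph is $4$.
   Context: $\mathbb{I}_n$ is the graph on $\{0,1\}^n$ where two strings are adjacent iff they differ in exactly one coordinate; its graph distance is the Hamming distance. $\mathcal{VR}(X;r)$ is the simplicial complex whose simplices are the finite subsets of $X$ of diameter at most $r$. For a finite simplicial complex $\Delta$, an elementary $d$-collapse removes from $\Delta$ all faces $\tau$ with $\gamma\subseteq\tau\subseteq\sigma$, where $\gamma\in\Delta$ has $|\gamma|\le d$ and $\sigma$ is the unique maximal face of $\Delta$ containing $\gamma$. $\Delta$ is $d$-collapsible if a finite sequence of elementary $d$-collapses reduces $\Delta$ to the void complex $\emptyset$. The collapsibility number of $\Delta$ is the minimal $d$ such that $\Delta$ is $d$-collapsible. -}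

module Defs where

open import Data.Bool using (Bool; true; false; _≟_)
open import Data.Nat using (ℕ; zero; suc; _≤_)
open import Data.Vec using (Vec; []; _∷_)
open import Data.List using (List; []; _∷_; map; _++_; length; filter)
open import Data.Product using (_×_; Σ)
open import Relation.Binary.PropositionalEquality using (_≡_)
open import Relation.Nullary using (¬_; yes; no)


-- The hypercube graph 𝕀ₙ: vertices {0,1}ⁿ, graph distance = Hamming distance

Vertex : ℕ → Set
Vertex n = Vec Bool n

hamming : ∀ {n} → Vertex n → Vertex n → ℕ
hamming []       []       = 0
hamming (x ∷ xs) (y ∷ ys) with x ≟ y
... | yes _ = hamming xs ys
... | no  _ = suc (hamming xs ys)

allVertices : (n : ℕ) → List (Vertex n)
allVertices zero    = [] ∷ []
allVertices (suc n) = map (true ∷_) (allVertices n) ++ map (false ∷_) (allVertices n)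

Face : ℕ → Set
Face n = Vertex n → Bool

_∈F_ : ∀ {n} → Vertex n → Face n → Set
v ∈F τ = τ v ≡ true

_⊆F_ : ∀ {n} → Face n → Face n → Set
τ ⊆F σ = ∀ v → v ∈F τ → v ∈F σ

_≈F_ : ∀ {n} → Face n → Face n → Set
τ ≈F σ = (τ ⊆F σ) × (σ ⊆F τ)

card : ∀ {n} → Face n → ℕ
card {n} γ = length (filter (λ v → γ v ≟ true) (allVertices n))

Complex : ℕ → Set₁
Complex n = Face n → Set

-- Vietoris–Rips complex VR(𝕀ₙ; r): subsets of diameter ≤ r
-- (the empty set is a face).
VR : (n r : ℕ) → Complex n
VR n r τ = ∀ u v → u ∈F τ → v ∈F τ → hamming u v ≤ r

IsMaximal : ∀ {n} → Complex n → Face n → Set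
IsMaximal Δ σ = Δ σ × (∀ τ → Δ τ → σ ⊆F τ → τ ⊆F σ)

UniqueMaxFaceContaining : ∀ {n} → Complex n → Face n → Face n → Set
UniqueMaxFaceContaining Δ γ σ =
  IsMaximal Δ σ × (γ ⊆F σ) × (∀ τ → IsMaximal Δ τ → γ ⊆F τ → τ ≈F σ)

removeInterval : ∀ {n} → Complex n → Face n → Face n → Complex n
removeInterval Δ γ σ τ = Δ τ × ¬ ((γ ⊆F τ) × (τ ⊆F σ))

IsVoid : ∀ {n} → Complex n → Set
IsVoid Δ = ∀ τ → ¬ Δ τ

data Collapsible {n : ℕ} (d : ℕ) : Complex n → Set₁ where
  done : ∀ {Δ} → IsVoid Δ → Collapsible d Δ
  step : ∀ {Δ} (γ σ : Face n) → Δ γ → card γ ≤ d →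
         UniqueMaxFaceContaining Δ γ σ →
         Collapsible d (removeInterval Δ γ σ) → Collapsible d Δ

CollapsibilityNumber : ∀ {n} → Complex n → ℕ → Set₁
CollapsibilityNumber Δ d = Collapsible d Δ × (∀ d′ → Collapsible d′ Δ → d ≤ d′)

{-# OPTIONS --safe #-}
-- Lower bound: a subcube of dimension three spans in VR(𝕀ₙ;2) the boundary of
-- a cross-polytope with four antipodal pairs.  A face γ of it with at most
-- three vertices misses some pair {c, c′}; as γ ∪ {c} and γ ∪ {c′} are both
-- faces, a unique maximal face above γ would contain c and c′, which are too
-- far apart.  Hence no elementary 3-collapse ever touches the cross-polytope.
--
-- Upper bound: every 4-clique lies in a unique maximal clique, since four
-- distinct pairwise close vertices cannot all be close to two vertices x, y at
-- distance at least 3.  Ordering the vertices, one removes the faces containing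
-- a given F by first removing those containing F ∪ {v}, for v running through
-- the remaining vertices; the recursion bottoms out when |F| = 4, or when no
-- vertices remain, and there all faces above F go in one elementary collapse.
module Submission where

open import Defs
open import Data.Bool using (Bool; true; false; not; _∨_; _xor_; if_then_else_)
import Data.Bool as Bool
open import Data.Bool.Properties using (not-injective)
open import Data.Empty using (⊥-elim)
open import Data.Fin using (Fin; zero; suc)
import Data.Fin as Fin
open import Data.Fin.Properties using (pigeonhole; injective⇒≤; <⇒≢)
open import Data.List using (List; []; _∷_; length; lookup; filter; map)
open import Data.List.Membership.Propositional using (_∈_; _∉_)
open import Data.List.Membership.Propositional.Properties
  using (∈-lookup; ∈-filter⁺; ∈-filter⁻; ∈-map⁺; ∈-map⁻; ∈-++⁺ˡ; ∈-++⁺ʳ)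
open import Data.List.Membership.Setoid.Properties using (index-injective)
open import Data.List.Properties using (length-map; length-filter)
open import Data.List.Relation.Unary.All using (All; []; _∷_; all?)
import Data.List.Relation.Unary.All as All
open import Data.List.Relation.Unary.AllPairs using ([]; _∷_)
open import Data.List.Relation.Unary.Any using (here; there; index; any?; satisfied)
import Data.List.Relation.Unary.Any as Any
open import Data.List.Relation.Unary.Unique.Propositional using (Unique)
import Data.List.Relation.Unary.Unique.Propositional.Properties as Unique
open import Data.Nat using (ℕ; zero; suc; _+_; _≤_; _<_; z≤n; s≤s; _≤?_)
open import Data.Nat.Properties hiding (<⇒≢; _≟_)
open import Data.Product using (Σ; ∃; ∃₂; _×_; _,_; proj₁; proj₂)
open import Data.Sum using (_⊎_; inj₁; inj₂; map₂)
open import Data.Vec using ([]; _∷_; replicate)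
import Data.Vec as Vec
open import Data.Vec.Properties using (∷-injective; ∷-injectiveʳ; ≡-dec)
open import Function using (_∘_; Injective)
open import Relation.Binary.PropositionalEquality
  using (_≡_; _≢_; refl; sym; trans; cong; cong₂; subst; subst₂; setoid)
open import Relation.Nullary
  using (¬_; Dec; yes; no; does; contradiction; _×-dec_; _⊎-dec_)
open import Relation.Nullary.Decidable using (dec-true)

private variable
  A : Set
  n r d m : ℕ

-- Counting with duplicate-free lists and faces.

lookup-injective : {xs : List A} → Unique xs → Injective _≡_ _≡_ (lookup xs)
lookup-injective (_ ∷ _)  {zero}  {zero}  _ = refl
lookup-injective (x∉ ∷ _) {zero}  {suc j} e = contradiction e (All.lookup x∉ (∈-lookup j))
lookup-injective (x∉ ∷ _) {suc i} {zero}  e = contradiction (sym e) (All.lookup x∉ (∈-lookup i))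
lookup-injective (_ ∷ u)  {suc i} {suc j} e = cong suc (lookup-injective u e)

-- Sending a position in `xs` to the position of the same element in `ys` is an injection of finite
-- index sets.
length-mono-⊆ : {xs ys : List A} → Unique xs → (∀ {x} → x ∈ xs → x ∈ ys) →
                length xs ≤ length ys
length-mono-⊆ {xs = xs} u xs⊆ys = injective⇒≤
  {f = λ i → index (xs⊆ys (∈-lookup {xs = xs} i))}
  λ e → lookup-injective u (index-injective (setoid _) (xs⊆ys (∈-lookup _)) (xs⊆ys (∈-lookup _)) e)

does⁻ : (a? : Dec A) → does a? ≡ true → A
does⁻ (yes a) _ = a

_≟_ : (u v : Vertex n) → Dec (u ≡ v)
_≟_ = ≡-dec Bool._≟_

∈-allVertices : (v : Vertex n) → v ∈ allVertices n
∈-allVertices []          = here refl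
∈-allVertices (true ∷ v)  = ∈-++⁺ˡ (∈-map⁺ (true ∷_) (∈-allVertices v))
∈-allVertices (false ∷ v) = ∈-++⁺ʳ (map (true ∷_) (allVertices _)) (∈-map⁺ (false ∷_) (∈-allVertices v))

allVertices-unique : (n : ℕ) → Unique (allVertices n)
allVertices-unique zero    = [] ∷ []
allVertices-unique (suc n) = Unique.++⁺
  (Unique.map⁺ ∷-injectiveʳ (allVertices-unique n))
  (Unique.map⁺ ∷-injectiveʳ (allVertices-unique n))
  λ (p , q) → heads-differ (∈-map⁻ _ p) (∈-map⁻ _ q)
  where
  heads-differ : {v : Vertex (suc n)} → (∃ λ u → u ∈ allVertices n × v ≡ true ∷ u) →
                 ¬ (∃ λ u → u ∈ allVertices n × v ≡ false ∷ u)
  heads-differ (_ , _ , refl) (_ , _ , ())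

-- This is the very list measured by `card`, so cardinality bounds reduce definitionally to lengths
-- of lists.
elements : Face n → List (Vertex n)
elements {n} τ = filter (λ v → τ v Bool.≟ true) (allVertices n)

∈-elements⁺ : (τ : Face n) {v : Vertex n} → v ∈F τ → v ∈ elements τ
∈-elements⁺ τ = ∈-filter⁺ (λ v → τ v Bool.≟ true) (∈-allVertices _)

∈-elements⁻ : (τ : Face n) {v : Vertex n} → v ∈ elements τ → v ∈F τ
∈-elements⁻ {n} τ p = proj₂ (∈-filter⁻ (λ v → τ v Bool.≟ true) {xs = allVertices n} p)

elements-unique : (τ : Face n) → Unique (elements τ)
elements-unique τ = Unique.filter⁺ (λ v → τ v Bool.≟ true) (allVertices-unique _)

card-≥ : (τ : Face n) {xs : List (Vertex n)} → Unique xs → (∀ {v} → v ∈ xs → v ∈F τ) →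
         length xs ≤ card τ
card-≥ τ u xs⊆τ = length-mono-⊆ u (∈-elements⁺ τ ∘ xs⊆τ)

card-≤ : (τ : Face n) {xs : List (Vertex n)} → (∀ {v} → v ∈F τ → v ∈ xs) → card τ ≤ length xs
card-≤ τ τ⊆xs = length-mono-⊆ (elements-unique τ) (τ⊆xs ∘ ∈-elements⁻ τ)

card-< : (τ σ : Face n) {v : Vertex n} → τ ⊆F σ → v ∈F σ → τ v ≡ false → card τ < card σ
card-< τ σ {v} τ⊆σ v∈σ v∉τ = card-≥ σ
  (All.tabulate (λ u∈ → λ { refl → contradiction (trans (sym (∈-elements⁻ τ u∈)) v∉τ) λ () })
    ∷ elements-unique τ)
  λ { (here refl) → v∈σ ; (there u∈) → τ⊆σ _ (∈-elements⁻ τ u∈) }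

-- Hamming distance and isometries.

hamming-self : (u : Vertex n) → hamming u u ≡ 0
hamming-self []          = refl
hamming-self (true ∷ u)  = hamming-self u
hamming-self (false ∷ u) = hamming-self u

hamming-sym : (u v : Vertex n) → hamming u v ≡ hamming v u
hamming-sym []          []          = refl
hamming-sym (true ∷ u)  (true ∷ v)  = hamming-sym u v
hamming-sym (true ∷ u)  (false ∷ v) = cong suc (hamming-sym u v)
hamming-sym (false ∷ u) (true ∷ v)  = cong suc (hamming-sym u v)
hamming-sym (false ∷ u) (false ∷ v) = hamming-sym u v

hamming≤0⇒≡ : (u v : Vertex n) → hamming u v ≤ 0 → u ≡ v
hamming≤0⇒≡ []          []          _ = refl
hamming≤0⇒≡ (true ∷ u)  (true ∷ v)  h = cong (true ∷_) (hamming≤0⇒≡ u v h)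
hamming≤0⇒≡ (false ∷ u) (false ∷ v) h = cong (false ∷_) (hamming≤0⇒≡ u v h)
hamming≤0⇒≡ (true ∷ u)  (false ∷ v) ()
hamming≤0⇒≡ (false ∷ u) (true ∷ v)  ()

δ : Bool → Bool → ℕ
δ x y = if x xor y then 1 else 0

hamming-∷ : ∀ x y (u v : Vertex n) → hamming (x ∷ u) (y ∷ v) ≡ δ x y + hamming u v
hamming-∷ true  true  u v = refl
hamming-∷ true  false u v = refl
hamming-∷ false true  u v = refl
hamming-∷ false false u v = refl

hamming-xor : ∀ b x y (u v : Vertex n) →
              hamming ((b xor x) ∷ u) ((b xor y) ∷ v) ≡ hamming (x ∷ u) (y ∷ v)
hamming-xor true  true  true  u v = refl
hamming-xor true  true  false u v = refl
hamming-xor true  false true  u v = refl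
hamming-xor true  false false u v = refl
hamming-xor false x     y     u v = refl

hamming-swap : ∀ x x′ y y′ (u v : Vertex n) →
               hamming (x ∷ x′ ∷ u) (y ∷ y′ ∷ v) ≡ hamming (x′ ∷ x ∷ u) (y′ ∷ y ∷ v)
hamming-swap x x′ y y′ u v
  rewrite hamming-∷ x y (x′ ∷ u) (y′ ∷ v) | hamming-∷ x′ y′ u v
        | hamming-∷ x′ y′ (x ∷ u) (y ∷ v) | hamming-∷ x y u v
        | sym (+-assoc (δ x y) (δ x′ y′) (hamming u v))
        | +-comm (δ x y) (δ x′ y′) = +-assoc (δ x′ y′) (δ x y) (hamming u v)

hamming-++ : (u v : Vertex m) (w : Vertex n) → hamming (u Vec.++ w) (v Vec.++ w) ≡ hamming u v
hamming-++ []      []      w = hamming-self w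
hamming-++ (x ∷ u) (y ∷ v) w
  rewrite hamming-∷ x y (u Vec.++ w) (v Vec.++ w) | hamming-∷ x y u v
  = cong (δ x y +_) (hamming-++ u v w)

Isometric : (Vertex n → Vertex m) → Set
Isometric φ = ∀ u v → hamming (φ u) (φ v) ≡ hamming u v

isometric-injective : (φ : Vertex n → Vertex m) → Isometric φ → ∀ {u v} → φ u ≡ φ v → u ≡ v
isometric-injective φ iso {u} {v} e = hamming≤0⇒≡ u v
  (≤-reflexive (trans (sym (iso u v)) (trans (cong (hamming (φ u)) (sym e)) (hamming-self (φ u)))))

-- The lower bound

Extends : Complex n → Face n → Set
Extends Δ τ = ∃ λ σ → IsMaximal Δ σ × τ ⊆F σ

-- `Δ` is an arbitrary predicate, so whether a face can be enlarged is undecidable; hence the double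
-- negation. If nothing maximal lay above `τ`, the same would hold for every larger face, and by
-- induction there would be none, making `τ` itself maximal. The fuel `k` works because each
-- enlargement raises `card`, which never exceeds the number of vertices.
¬¬extends : (Δ : Complex n) (k : ℕ) (τ : Face n) → length (allVertices n) < card τ + k →
            Δ τ → ¬ ¬ Extends Δ τ
¬¬extends {n} Δ zero τ big _ _ = <-irrefl refl (<-≤-trans big
  (≤-trans (≤-reflexive (+-identityʳ _)) (length-filter (λ v → τ v Bool.≟ true) (allVertices n))))
¬¬extends {n} Δ (suc k) τ big Δτ none = none (τ , (Δτ , maximal) , λ _ v∈τ → v∈τ)
  where
  maximal : ∀ τ′ → Δ τ′ → τ ⊆F τ′ → τ′ ⊆F τ
  maximal τ′ Δτ′ τ⊆τ′ v v∈τ′ with τ v in eq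
  ... | true  = refl
  ... | false = ⊥-elim (¬¬extends Δ k τ′
    (<-≤-trans big (≤-trans (≤-reflexive (+-suc (card τ) k))
      (+-monoˡ-≤ k (card-< τ τ′ τ⊆τ′ v∈τ′ eq))))
    Δτ′ λ (σ , max , τ′⊆σ) → none (σ , max , λ u u∈τ → τ′⊆σ u (τ⊆τ′ u u∈τ)))

-- The two signs `b` give antipodal vertices. Prepending `false` picks one representative per
-- antipodal pair, so `u` indexes the pairs.
corner : Bool → Vertex r → Vertex (suc r)
corner b u = Vec.map (b xor_) (false ∷ u)

map-xor-injective : ∀ b (u v : Vertex n) → Vec.map (b xor_) u ≡ Vec.map (b xor_) v → u ≡ v
map-xor-injective b []      []      _ = refl
map-xor-injective b (x ∷ u) (y ∷ v) e =
  cong₂ _∷_ (xor-injective b (proj₁ (∷-injective e))) (map-xor-injective b u v (proj₂ (∷-injective e)))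
  where
  xor-injective : ∀ b {x y} → b xor x ≡ b xor y → x ≡ y
  xor-injective true  = not-injective
  xor-injective false e = e

-- The head of `corner b u` is `b`, so unequal signs cannot occur. This makes vertices chosen from
-- different pairs distinct, whatever the signs.
corner-injective : ∀ b c {u v : Vertex r} → corner b u ≡ corner c v → u ≡ v
corner-injective true  true  e = map-xor-injective true _ _ (∷-injectiveʳ e)
corner-injective false false e = map-xor-injective false _ _ (∷-injectiveʳ e)
corner-injective true  false ()
corner-injective false true  ()

-- Each coordinate of `v` disagrees with exactly one of the two antipodes.
hamming-antipodes : ∀ b (v u : Vertex n) →
  hamming v (Vec.map (b xor_) u) + hamming v (Vec.map (not b xor_) u) ≡ n
hamming-antipodes b []      []      = refl
hamming-antipodes b (x ∷ v) (y ∷ u)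
  rewrite hamming-∷ x (b xor y) v (Vec.map (b xor_) u)
        | hamming-∷ x (not b xor y) v (Vec.map (not b xor_) u) = split b x y
  where
  h  = hamming v (Vec.map (b xor_) u)
  h′ = hamming v (Vec.map (not b xor_) u)
  ih : h + h′ ≡ _
  ih = hamming-antipodes b v u
  split : ∀ b x y → (δ x (b xor y) + h) + (δ x (not b xor y) + h′) ≡ suc _
  split true  true  true  = cong suc ih
  split true  true  false = trans (+-suc h h′) (cong suc ih)
  split true  false true  = trans (+-suc h h′) (cong suc ih)
  split true  false false = cong suc ih
  split false true  true  = trans (+-suc h h′) (cong suc ih)
  split false true  false = cong suc ih
  split false false true  = cong suc ih
  split false false false = trans (+-suc h h′) (cong suc ih)

insert : Vertex n → Face n → Face n
insert v τ u = does (u ≟ v) ∨ τ u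

∈-insert⁻ : ∀ (τ : Face n) {u v} → u ∈F insert v τ → u ≡ v ⊎ u ∈F τ
∈-insert⁻ τ {u} {v} p with u ≟ v
... | yes e = inj₁ e
... | no _  = inj₂ p

∈-insert-self : ∀ (τ : Face n) v → v ∈F insert v τ
∈-insert-self τ v rewrite dec-true (v ≟ v) refl = refl

⊆-insert : ∀ (τ : Face n) v → τ ⊆F insert v τ
⊆-insert τ v u u∈τ with u ≟ v
... | yes _ = refl
... | no _  = u∈τ

module _ (φ : Vertex (suc r) → Vertex n) (iso : Isometric φ) where

  InCube : Face n → Set
  InCube τ = ∀ v → v ∈F τ → ∃ λ u → v ≡ φ u

  Misses : Face n → Vertex r → Set
  Misses γ u = ∀ b → γ (φ (corner b u)) ≡ false

  misses? : ∀ γ u → Misses γ u ⊎ ∃ λ b → φ (corner b u) ∈F γ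
  misses? γ u with γ (φ (corner true u)) in p | γ (φ (corner false u)) in q
  ... | true  | _     = inj₂ (true , p)
  ... | false | true  = inj₂ (false , q)
  ... | false | false = inj₁ λ { true → p ; false → q }

  -- Otherwise choosing a vertex of `γ` from every antipodal pair would give as many distinct
  -- vertices of `γ` as there are pairs.
  small⇒misses : ∀ γ → card γ < length (allVertices r) → ∃ (Misses γ)
  small⇒misses γ small with any? missed? (allVertices r)
    where
    missed? : ∀ u → Dec (Misses γ u)
    missed? u with misses? γ u
    ... | inj₁ miss      = yes miss
    ... | inj₂ (b , hit) = no λ miss → contradiction (trans (sym hit) (miss b)) λ ()
  ... | yes some = satisfied some
  ... | no none  = contradiction small (≤⇒≯ large)
    where
    hit : ∀ u → ∃ λ b → φ (corner b u) ∈F γ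
    hit u with misses? γ u
    ... | inj₁ miss = contradiction (Any.map (λ { refl → miss }) (∈-allVertices u)) none
    ... | inj₂ h    = h
    pick : Vertex r → Vertex n
    pick u = φ (corner (proj₁ (hit u)) u)
    large : length (allVertices r) ≤ card γ
    large = subst (_≤ card γ) (length-map pick (allVertices r))
      (card-≥ γ
        (Unique.map⁺ (λ {u} {v} e → corner-injective (proj₁ (hit u)) (proj₁ (hit v))
                                      (isometric-injective φ iso e))
                     (allVertices-unique r))
        λ v∈ → let (u , _ , e) = ∈-map⁻ pick v∈ in subst (_∈F γ) (sym e) (proj₂ (hit u)))

  -- Only the antipode of a corner is farther than `r` from it in the cube. A vertex of `γ` is not
  -- that antipode, so its distance to the antipode is positive, and the two distances add up to
  -- `suc r`.
  corner-near : ∀ γ {u} → InCube γ → Misses γ u → ∀ b v → v ∈F γ → hamming v (φ (corner b u)) ≤ r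
  corner-near γ {u} inCube miss b v v∈γ with inCube v v∈γ
  ... | x , refl with hamming x (corner (not b) u) in eq
  ... | zero  = contradiction
    (trans (sym v∈γ) (trans (cong (γ ∘ φ) (hamming≤0⇒≡ x _ (≤-reflexive eq))) (miss (not b)))) λ ()
  ... | suc k = subst (_≤ r) (sym (iso x _)) (≤-pred (begin
    suc (hamming x (corner b u))                                ≤⟨ s≤s (m≤m+n _ k) ⟩
    suc (hamming x (corner b u) + k)                            ≡⟨ +-suc _ k ⟨
    hamming x (corner b u) + suc k                              ≡⟨ cong (hamming x (corner b u) +_) eq ⟨
    hamming x (corner b u) + hamming x (corner (not b) u)       ≡⟨ hamming-antipodes b x (false ∷ u) ⟩
    suc r                                                       ∎))
    where open ≤-Reasoning

  insert-corner-VR : ∀ γ {u} → InCube γ → VR n r γ → Misses γ u →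
                     ∀ b → VR n r (insert (φ (corner b u)) γ)
  insert-corner-VR γ {u} inCube vr miss b v w v∈ w∈ with ∈-insert⁻ γ v∈ | ∈-insert⁻ γ w∈
  ... | inj₁ refl | inj₁ refl = subst (_≤ r) (sym (hamming-self (φ (corner b u)))) z≤n
  ... | inj₂ v∈γ  | inj₂ w∈γ  = vr v w v∈γ w∈γ
  ... | inj₂ v∈γ  | inj₁ refl = corner-near γ inCube miss b v v∈γ
  ... | inj₁ refl | inj₂ w∈γ  = subst (_≤ r) (hamming-sym w v) (corner-near γ inCube miss b w w∈γ)

  -- The invariant is that `Δ` lies inside the Vietoris-Rips complex and keeps all of its faces in
  -- the cube. It rules out the void complex through the empty face, and it persists because a
  -- collapsed `γ` never lies in the cube, so no face above `γ` does either.
  cube-survives : {Δ : Complex n} → d < length (allVertices r) → Collapsible d Δ →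
                  (∀ τ → Δ τ → VR n r τ) → ¬ (∀ τ → InCube τ → VR n r τ → Δ τ)
  cube-survives _ (done void) Δ⊆VR cube⊆Δ =
    void (λ _ → false) (cube⊆Δ _ (λ _ ()) (λ _ _ ()))
  cube-survives {Δ = Δ} d< (step γ σ Δγ γ≤d ((Δσ , _) , _ , unique) rest) Δ⊆VR cube⊆Δ =
    cube-survives d< rest (λ τ → Δ⊆VR τ ∘ proj₁)
      λ τ inCube vr → cube⊆Δ τ inCube vr , λ (γ⊆τ , _) → γ⊈cube λ v → inCube v ∘ γ⊆τ v
    where
    γ⊈cube : ¬ InCube γ
    γ⊈cube inCube with small⇒misses γ (≤-<-trans γ≤d d<)
    -- The goal is absurdity, so knowing up to double negation that `σ` contains both antipodes
    -- suffices.
    ... | u , miss = corner∈σ true λ p → corner∈σ false λ q →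
      <-irrefl refl (subst (_≤ r) far (Δ⊆VR σ Δσ _ _ p q))
      where
      insert-inCube : ∀ b → InCube (insert (φ (corner b u)) γ)
      insert-inCube b v v∈ with ∈-insert⁻ γ v∈
      ... | inj₁ e   = _ , e
      ... | inj₂ v∈γ = inCube v v∈γ
      corner∈σ : ∀ b → ¬ ¬ (φ (corner b u) ∈F σ)
      -- The inferred fuel is one more than the number of vertices, enough for any `γ′`. A maximal
      -- face above `γ′` also lies above `γ`, hence is `σ`.
      corner∈σ b ∉σ = ¬¬extends Δ _ γ′ (m≤n+m _ (card γ′))
        (cube⊆Δ γ′ (insert-inCube b) (insert-corner-VR γ inCube (Δ⊆VR γ Δγ) miss b))
        λ (τ , max , γ′⊆τ) → ∉σ (proj₁ (unique τ max λ v → γ′⊆τ v ∘ ⊆-insert γ _ v) _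
          (γ′⊆τ _ (∈-insert-self γ _)))
        where γ′ = insert (φ (corner b u)) γ
      far : hamming (φ (corner true u)) (φ (corner false u)) ≡ suc r
      -- The antipode identity is applied at `corner true u` itself, where its first summand
      -- vanishes.
      far = trans (iso _ _) (trans
        (cong (_+ hamming (corner true u) (corner false u)) (sym (hamming-self (corner true u))))
        (hamming-antipodes true (corner true u) (false ∷ u)))

-- The embedded cube uses the first `suc r` coordinates, with all others set to `false`. It has one
-- antipodal pair for each vertex of the `r`-cube.
VR-collapsible⇒≥ : (m : ℕ) → Collapsible d (VR (suc r + m) r) → length (allVertices r) ≤ d
VR-collapsible⇒≥ {d} {r} m coll with length (allVertices r) ≤? d
... | yes p = p
... | no ¬p = ⊥-elim (cube-survives (Vec._++ replicate m false)
  (λ u v → hamming-++ u v (replicate m false)) (≰⇒> ¬p) coll (λ _ vr → vr) (λ _ _ vr → vr))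

-- The upper bound

Near : ℕ → Vertex n → List (Vertex n) → Set
Near r v = All (λ u → hamming v u ≤ r)

Clique : ℕ → List (Vertex n) → Set
Clique r F = All (λ v → Near r v F) F

near? : ∀ r (v : Vertex n) F → Dec (Near r v F)
near? r v = all? (λ u → hamming v u ≤? r)

clique? : ∀ r (F : List (Vertex n)) → Dec (Clique r F)
clique? r F = all? (λ v → near? r v F) F

-- Moving the differences of two vertices to the front.

Normalised : ℕ → Vertex n → Vertex n → Set
Normalised {n} k x y = ∃ λ m → Σ (Vertex n → Vertex (k + m)) λ φ → Isometric φ ×
  ∃₂ λ x′ y′ → φ x ≡ replicate k false Vec.++ x′ × φ y ≡ replicate k true Vec.++ y′

on-tail : (Vertex n → Vertex m) → Vertex (suc n) → Vertex (suc m)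
on-tail φ (z ∷ w) = z ∷ φ w

on-tail-isometric : {φ : Vertex n → Vertex m} → Isometric φ → Isometric (on-tail φ)
on-tail-isometric {φ = φ} iso (z ∷ w) (z′ ∷ w′)
  rewrite hamming-∷ z z′ (φ w) (φ w′) | hamming-∷ z z′ w w′ = cong (δ z z′ +_) (iso w w′)

swap : Vertex (suc (suc n)) → Vertex (suc (suc n))
swap (x ∷ y ∷ u) = y ∷ x ∷ u

swap-isometric : Isometric (swap {n})
swap-isometric (x ∷ x′ ∷ u) (y ∷ y′ ∷ v) = hamming-swap x′ x y′ y u v

-- Recursion runs to the first differing coordinate. It is carried forward by swapping it past the
-- agreeing heads, and flipped when `x` has `true` there; the other differences stay in the tails.
differ-at-head : ∀ {k} (x y : Vertex n) → suc k ≤ hamming x y →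
  ∃ λ m → Σ (Vertex n → Vertex (suc m)) λ φ → Isometric φ ×
  ∃₂ λ x′ y′ → φ x ≡ false ∷ x′ × φ y ≡ true ∷ y′ × k ≤ hamming x′ y′
differ-at-head {suc n} {k} = go
  where
  Result : Vertex (suc n) → Vertex (suc n) → Set
  Result x y = ∃ λ m → Σ (Vertex (suc n) → Vertex (suc m)) λ φ → Isometric φ ×
    ∃₂ λ x′ y′ → φ x ≡ false ∷ x′ × φ y ≡ true ∷ y′ × k ≤ hamming x′ y′
  agree : ∀ z u v → suc k ≤ hamming u v → Result (z ∷ u) (z ∷ v)
  agree z u v h with differ-at-head u v h
  ... | _ , φ , iso , x′ , y′ , ex , ey , h′ =
    _ , swap ∘ on-tail φ
    , (λ w w′ → trans (swap-isometric (on-tail φ w) (on-tail φ w′)) (on-tail-isometric iso w w′))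
    , z ∷ x′ , z ∷ y′
    , cong (λ w → swap (z ∷ w)) ex , cong (λ w → swap (z ∷ w)) ey
    , subst (k ≤_) (sym (same z)) h′
    where
    same : ∀ z → hamming (z ∷ x′) (z ∷ y′) ≡ hamming x′ y′
    same true  = refl
    same false = refl
  go : ∀ x y → suc k ≤ hamming x y → Result x y
  go (true ∷ u)  (true ∷ v)  h = agree true u v h
  go (false ∷ u) (false ∷ v) h = agree false u v h
  go (false ∷ u) (true ∷ v)  h =
    _ , (λ w → w) , (λ _ _ → refl) , u , v , refl , refl , ≤-pred h
  go (true ∷ u)  (false ∷ v) h =
    _ , (λ { (z ∷ w) → not z ∷ w }) , (λ { (z ∷ w) (z′ ∷ w′) → hamming-xor true z z′ w w′ })
    , u , v , refl , refl , ≤-pred h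
differ-at-head {zero} [] [] ()

normalise : ∀ k (x y : Vertex n) → k ≤ hamming x y → Normalised k x y
normalise zero    x y _ = _ , (λ w → w) , (λ _ _ → refl) , x , y , refl , refl
normalise (suc k) x y h with differ-at-head x y h
... | _ , φ , iso , u , v , ex , ey , h′ with normalise k u v h′
... | _ , ψ , iso′ , x′ , y′ , ex′ , ey′ =
  _ , on-tail ψ ∘ φ
  , (λ w w′ → trans (on-tail-isometric iso′ (φ w) (φ w′)) (iso w w′))
  , x′ , y′ , trans (cong (on-tail ψ) ex) (cong (false ∷_) ex′)
  , trans (cong (on-tail ψ) ey) (cong (true ∷_) ey′)

-- The six vertices within distance 2 of both x = 000x′ and y = 111y′ come in
-- three pairs at distance at least 3.
module _ (x y : Vertex m) where

  common : Fin 3 → Bool → Vertex (3 + m)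
  common zero             true  = true  ∷ false ∷ false ∷ y
  common zero             false = false ∷ true  ∷ true  ∷ x
  common (suc zero)       true  = false ∷ true  ∷ false ∷ y
  common (suc zero)       false = true  ∷ false ∷ true  ∷ x
  common (suc (suc zero)) true  = false ∷ false ∷ true  ∷ y
  common (suc (suc zero)) false = true  ∷ true  ∷ false ∷ x

  -- The three leading bits of `z` disagree with those of one of the two vertices twice and of the
  -- other once, for all three disagreements would exceed the bound. The vertex with two
  -- disagreements has its allowance used up, so `z` shares its tail.
  near⇒common : ∀ z → hamming (false ∷ false ∷ false ∷ x) z ≤ 2 →
                hamming (true ∷ true ∷ true ∷ y) z ≤ 2 → ∃₂ λ i s → z ≡ common i s
  near⇒common (true ∷ true ∷ true ∷ z) (s≤s (s≤s ())) _
  near⇒common (false ∷ false ∷ false ∷ z) _ (s≤s (s≤s ()))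
  near⇒common (true ∷ false ∷ false ∷ z) _ (s≤s (s≤s h)) =
    zero , true , cong (λ w → true ∷ false ∷ false ∷ w) (sym (hamming≤0⇒≡ y z h))
  near⇒common (false ∷ true ∷ false ∷ z) _ (s≤s (s≤s h)) =
    suc zero , true , cong (λ w → false ∷ true ∷ false ∷ w) (sym (hamming≤0⇒≡ y z h))
  near⇒common (false ∷ false ∷ true ∷ z) _ (s≤s (s≤s h)) =
    suc (suc zero) , true , cong (λ w → false ∷ false ∷ true ∷ w) (sym (hamming≤0⇒≡ y z h))
  near⇒common (false ∷ true ∷ true ∷ z) (s≤s (s≤s h)) _ =
    zero , false , cong (λ w → false ∷ true ∷ true ∷ w) (sym (hamming≤0⇒≡ x z h))
  near⇒common (true ∷ false ∷ true ∷ z) (s≤s (s≤s h)) _ =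
    suc zero , false , cong (λ w → true ∷ false ∷ true ∷ w) (sym (hamming≤0⇒≡ x z h))
  near⇒common (true ∷ true ∷ false ∷ z) (s≤s (s≤s h)) _ =
    suc (suc zero) , false , cong (λ w → true ∷ true ∷ false ∷ w) (sym (hamming≤0⇒≡ x z h))

  common-near⇒≡ : ∀ i s t → hamming (common i s) (common i t) ≤ 2 → common i s ≡ common i t
  common-near⇒≡ i true  true  _ = refl
  common-near⇒≡ i false false _ = refl
  common-near⇒≡ zero             true  false (s≤s (s≤s ()))
  common-near⇒≡ zero             false true  (s≤s (s≤s ()))
  common-near⇒≡ (suc zero)       true  false (s≤s (s≤s ()))
  common-near⇒≡ (suc zero)       false true  (s≤s (s≤s ()))
  common-near⇒≡ (suc (suc zero)) true  false (s≤s (s≤s ()))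
  common-near⇒≡ (suc (suc zero)) false true  (s≤s (s≤s ()))

-- If `x` and `y` were too far apart, two of the four vertices would fall into the same one of the
-- three pairs; being close, they would coincide.
four-clique-rigid : {F : List (Vertex n)} → Unique F → 4 ≤ length F → Clique 2 F →
                    ∀ x y → Near 2 x F → Near 2 y F → hamming x y ≤ 2
four-clique-rigid {F = F} F! 4≤F clique x y x~F y~F with hamming x y ≤? 2
... | yes h = h
... | no ¬h with normalise 3 x y (≰⇒> ¬h)
... | _ , φ , iso , x′ , y′ , ex , ey = ⊥-elim (clash (pigeonhole 4≤F (proj₁ ∘ position)))
  where
  position : ∀ i → ∃₂ λ p s → φ (lookup F i) ≡ common x′ y′ p s
  position i = near⇒common x′ y′ (φ (lookup F i)) (close ex x~F) (close ey y~F)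
    where
    close : ∀ {u v} → φ u ≡ v → Near 2 u F → hamming v (φ (lookup F i)) ≤ 2
    close {u} refl u~F = subst (_≤ 2) (sym (iso u _)) (All.lookup u~F (∈-lookup i))
  clash : ¬ (∃₂ λ i j → i Fin.< j × proj₁ (position i) ≡ proj₁ (position j))
  clash (i , j , i<j , e) = <⇒≢ i<j (lookup-injective F! (isometric-injective φ iso
      (trans ei (trans (common-near⇒≡ x′ y′ p s t close) (sym ej)))))
    where
    p = proj₁ (position i)
    s = proj₁ (proj₂ (position i))
    t = proj₁ (proj₂ (position j))
    ei : φ (lookup F i) ≡ common x′ y′ p s
    ei = proj₂ (proj₂ (position i))
    ej : φ (lookup F j) ≡ common x′ y′ p t
    ej = subst (λ q → φ (lookup F j) ≡ common x′ y′ q t) (sym e) (proj₂ (proj₂ (position j)))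
    close : hamming (common x′ y′ p s) (common x′ y′ p t) ≤ 2
    close = subst₂ (λ u v → hamming u v ≤ 2) ei ej (subst (_≤ 2) (sym (iso _ _))
      (All.lookup (All.lookup clique (∈-lookup i)) (∈-lookup j)))

-- Clearing the faces above a clique, vertex by vertex.

_⊑_ : List (Vertex n) → Face n → Set
F ⊑ τ = ∀ {v} → v ∈ F → v ∈F τ

-- The hypothesis `rigid` makes the common neighbourhood of a clique with at least `d` vertices a
-- face, which is then the largest face above the clique.
module _ {n r d : ℕ}
  (rigid : {F : List (Vertex n)} → Unique F → d ≤ length F → Clique r F →
           ∀ x y → Near r x F → Near r y F → hamming x y ≤ r) where

  open import Data.List.Membership.DecPropositional (_≟_ {n}) using (_∈?_)

  face : List (Vertex n) → Face n
  face F v = does (v ∈? F)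

  cone? : ∀ F vs v → Dec ((v ∈ F ⊎ v ∈ vs) × Near r v F)
  cone? F vs v = (v ∈? F ⊎-dec v ∈? vs) ×-dec near? r v F

  -- Every face above `F` with vertices in `F` and `vs` lies in this set, the candidate for the
  -- unique maximal face.
  cone : (F vs : List (Vertex n)) → Face n
  cone F vs v = does (cone? F vs v)

  Within : (F vs : List (Vertex n)) → Face n → Set
  Within F vs τ = ∀ {v} → v ∈F τ → v ∈ F ⊎ v ∈ vs

  -- Here `vs` holds the vertices not yet processed. Faces of `Δ` not above `F` are left
  -- unconstrained.
  StarIn : (F vs : List (Vertex n)) → Complex n → Set
  StarIn F vs Δ = ∀ τ → F ⊑ τ → (Δ τ → VR n r τ × Within F vs τ) × (VR n r τ × Within F vs τ → Δ τ)

  -- Only logical equivalence is asked, since iterated `removeInterval` gives nested predicates, not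
  -- a fixed normal form.
  Removes : List (Vertex n) → Complex n → Complex n → Set
  Removes F Δ Δ′ = ∀ τ → (Δ′ τ → Δ τ × ¬ F ⊑ τ) × (Δ τ × ¬ F ⊑ τ → Δ′ τ)

  -- A collapsing sequence is built from its first step, so each removal takes the rest of the
  -- sequence as a continuation.
  Continue : List (Vertex n) → Complex n → Set₁
  Continue F Δ = ∀ Δ′ → Removes F Δ Δ′ → Collapsible d Δ′

  collapse-cone : ∀ F vs Δ → length F ≤ d → StarIn F vs Δ →
                  (Clique r F → VR n r (cone F vs)) → Continue F Δ → Collapsible d Δ
  collapse-cone F vs Δ F≤d star cone-VR continue with clique? r F
  -- No face of `Δ` contains a non-clique, so there is nothing to remove and no step is spent.
  ... | no ¬clique = continue Δ λ τ → (λ Δτ → Δτ , λ F⊑τ → ¬clique (All.tabulate λ u∈ →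
      All.tabulate λ v∈ → proj₁ (proj₁ (star τ F⊑τ) Δτ) _ _ (F⊑τ u∈) (F⊑τ v∈))) , proj₁
  ... | yes clique = step γ σ Δγ γ≤d ((Δσ , λ τ Δτ σ⊆τ → ⊆cone τ Δτ λ v∈ → σ⊆τ _ (F⊑σ v∈))
                                     , γ⊆σ , unique)
      -- The interval from `γ` to `σ` consists of all faces above `F`, as lying below the cone is
      -- automatic for them.
      (continue _ λ τ → (λ (Δτ , kept) → Δτ , λ F⊑τ → kept (above⁻ F⊑τ , ⊆cone τ Δτ F⊑τ))
                      , λ (Δτ , kept) → Δτ , λ (γ⊆τ , _) → kept (above⁺ γ⊆τ))
    where
    γ = face F
    σ = cone F vs
    above⁺ : ∀ {τ} → γ ⊆F τ → F ⊑ τ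
    above⁺ γ⊆τ v∈ = γ⊆τ _ (dec-true (_ ∈? F) v∈)
    above⁻ : ∀ {τ} → F ⊑ τ → γ ⊆F τ
    above⁻ F⊑τ v v∈γ = F⊑τ (does⁻ (v ∈? F) v∈γ)
    ∈cone : ∀ {v} → (v ∈ F ⊎ v ∈ vs) → Near r v F → v ∈F σ
    ∈cone v∈ near = dec-true (cone? F vs _) (v∈ , near)
    F⊑σ : F ⊑ σ
    F⊑σ v∈ = ∈cone (inj₁ v∈) (All.lookup clique v∈)
    γ⊆σ = above⁻ {σ} F⊑σ
    Δσ : Δ σ
    Δσ = proj₂ (star σ F⊑σ) (cone-VR clique , λ v∈σ → proj₁ (does⁻ (cone? F vs _) v∈σ))
    ⊆cone : ∀ τ → Δ τ → F ⊑ τ → τ ⊆F σ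
    ⊆cone τ Δτ F⊑τ v v∈τ = let (vr , within) = proj₁ (star τ F⊑τ) Δτ in
      ∈cone (within v∈τ) (All.tabulate λ u∈ → vr v _ v∈τ (F⊑τ u∈))
    unique : ∀ τ → IsMaximal Δ τ → γ ⊆F τ → τ ≈F σ
    unique τ (Δτ , max) γ⊆τ = τ⊆σ , max σ Δσ τ⊆σ
      where τ⊆σ = ⊆cone τ Δτ (above⁺ γ⊆τ)
    Δγ : Δ γ
    Δγ = proj₂ (star γ (above⁺ {γ} λ _ v∈ → v∈))
      ( (λ u v u∈ v∈ → cone-VR clique u v (γ⊆σ u u∈) (γ⊆σ v v∈))
      , λ v∈γ → inj₁ (does⁻ (_ ∈? F) v∈γ))
    γ≤d : card γ ≤ d
    γ≤d = ≤-trans (card-≤ γ {F} λ v∈γ → does⁻ (_ ∈? F) v∈γ) F≤d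

  -- A face above `F` either contains the next vertex `v` or avoids it, and the two kinds are
  -- cleared in this order. The number `k` by which `F` falls short of `d` drops in the first call,
  -- the list `vs` in the second.
  clear : ∀ k F vs Δ → length F + k ≡ d → Unique F → Unique vs → (∀ {v} → v ∈ vs → v ∉ F) →
          StarIn F vs Δ → Continue F Δ → Collapsible d Δ
  clear zero F vs Δ size F! _ _ star = collapse-cone F vs Δ F≤d star
    λ clique u v u∈ v∈ → rigid F! d≤F clique u v
      (proj₂ (does⁻ (cone? F vs u) u∈)) (proj₂ (does⁻ (cone? F vs v) v∈))
    where
    d≤F = ≤-reflexive (trans (sym size) (+-identityʳ _))
    F≤d = ≤-reflexive (trans (sym (+-identityʳ _)) size)
  -- With no vertices left the cone lies inside `F`, so closeness to `F` already bounds its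
  -- diameter.
  clear (suc k) F [] Δ size F! _ _ star = collapse-cone F [] Δ (≤-trans (m≤m+n _ _) (≤-reflexive size)) star
    λ clique u v u∈ v∈ → All.lookup (proj₂ (does⁻ (cone? F [] u) u∈)) (∈F (proj₁ (does⁻ (cone? F [] v) v∈)))
    where
    ∈F : ∀ {v} → v ∈ F ⊎ v ∈ [] → v ∈ F
    ∈F (inj₁ v∈) = v∈
  clear (suc k) F (v ∷ vs) Δ size F! (v∉vs ∷ vs!) disjoint star continue =
    clear k (v ∷ F) vs Δ (trans (sym (+-suc _ k)) size) (All.tabulate (λ { u∈ refl → v∉F u∈ }) ∷ F!) vs!
      (λ { u∈vs (here refl) → All.lookup v∉vs u∈vs refl ; u∈vs (there u∈F) → disjoint (there u∈vs) u∈F })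
      star-v
      λ Δ′ rem → clear (suc k) F vs Δ′ size F! vs! (disjoint ∘ there) (star-rest Δ′ rem)
      λ Δ″ rem′ → continue Δ″ λ τ →
          (λ Δ″τ → let (Δ′τ , F⋢τ) = proj₁ (rem′ τ) Δ″τ in proj₁ (proj₁ (rem τ) Δ′τ) , F⋢τ)
        , λ (Δτ , F⋢τ) → proj₂ (rem′ τ) (proj₂ (rem τ) (Δτ , λ v∷F⊑τ → F⋢τ (v∷F⊑τ ∘ there)) , F⋢τ)
    where
    v∉F : v ∉ F
    v∉F = disjoint (here refl)
    shift : ∀ {u} → u ∈ F ⊎ u ∈ v ∷ vs → u ∈ v ∷ F ⊎ u ∈ vs
    shift (inj₁ u∈)          = inj₁ (there u∈)
    shift (inj₂ (here e))    = inj₁ (here e)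
    shift (inj₂ (there u∈))  = inj₂ u∈
    unshift : ∀ {u} → u ∈ v ∷ F ⊎ u ∈ vs → u ∈ F ⊎ u ∈ v ∷ vs
    unshift (inj₁ (here e))   = inj₂ (here e)
    unshift (inj₁ (there u∈)) = inj₁ u∈
    unshift (inj₂ u∈)         = inj₂ (there u∈)
    star-v : StarIn (v ∷ F) vs Δ
    star-v τ v∷F⊑τ = let (to , from) = star τ (v∷F⊑τ ∘ there) in
        (λ Δτ → let (vr , within) = to Δτ in vr , shift ∘ within)
      , λ (vr , within) → from (vr , unshift ∘ within)
    star-rest : ∀ Δ′ → Removes (v ∷ F) Δ Δ′ → StarIn F vs Δ′
    star-rest Δ′ rem τ F⊑τ = let (to , from) = star τ F⊑τ in
        (λ Δ′τ → let (Δτ , v∷F⋢τ) = proj₁ (rem τ) Δ′τ ; (vr , within) = to Δτ in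
          vr , λ u∈τ → drop-v (λ { refl → v∷F⋢τ λ { (here refl) → u∈τ ; (there w∈) → F⊑τ w∈ } }) (within u∈τ))
      -- A face within `F` and `vs` omits `v`, so the earlier removal did not touch it.
      , λ (vr , within) → proj₂ (rem τ) (from (vr , add-v ∘ within)
                                        , λ v∷F⊑τ → v∉ (within (v∷F⊑τ (here refl))))
      where
      drop-v : ∀ {u} → u ≢ v → u ∈ F ⊎ u ∈ v ∷ vs → u ∈ F ⊎ u ∈ vs
      drop-v u≢v (inj₁ u∈)         = inj₁ u∈
      drop-v u≢v (inj₂ (here e))   = contradiction e u≢v
      drop-v u≢v (inj₂ (there u∈)) = inj₂ u∈
      add-v : ∀ {u} → u ∈ F ⊎ u ∈ vs → u ∈ F ⊎ u ∈ v ∷ vs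
      add-v = map₂ there
      v∉ : ¬ (v ∈ F ⊎ v ∈ vs)
      v∉ (inj₁ v∈F)  = v∉F v∈F
      v∉ (inj₂ v∈vs) = All.lookup v∉vs v∈vs refl

  -- Clearing starts from the empty list: every face lies above it, so what remains at the end is
  -- void.
  VR-collapsible : Collapsible d (VR n r)
  VR-collapsible = clear d [] (allVertices n) (VR n r) refl [] (allVertices-unique n) (λ _ ())
    (λ τ _ → (λ vr → vr , λ _ → inj₂ (∈-allVertices _)) , proj₁)
    λ Δ rem → done λ τ Δτ → proj₂ (proj₁ (rem τ) Δτ) λ ()

theorem1p5 : (n : ℕ) → 3 ≤ n → CollapsibilityNumber (VR n 2) 4
theorem1p5 (suc (suc (suc m))) (s≤s (s≤s (s≤s z≤n))) =
  -- For `r = 2` the lower bound `length (allVertices r)` computes to 4, the size required of a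
  -- rigid clique.
  VR-collapsible four-clique-rigid , λ d → VR-collapsible⇒≥ m
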